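{- Let $p$ be a prime, $q=p^{r}$, $k\geq 3$ with $k\mid(q-1)$, $m=(q-1)/k$, $F=\mathrm{GF}(q)$, $\zeta$ a generator of $F^{*}$, $\varphi=\zeta^{m}$, and $\Phi=\langle\varphi\rangle$ the subgroup of order $k$. For $a\in F^{*}$, $c\in F$ let $[a,c]_{k}=|\Phi\cap(\Phi a+c)|$, and for $i,j\in\{1,\dots,k-1\}$ let $c_{j,i}=(\varphi^{j}-1)^{ -1}(\varphi^{i}-1)$, indices read modulo $k$ and represented in $\{0,\dots,k-1\}$. Suppose $(p,k)$ is circular, and let $a,c\in F$ with $a\neq 0$. Then $[a,c]_{k}=2$ if and only if $a\in\Phi c_{j,i}$ and $c\in\Phi c_{j,j-i}$ for some $i,j\in\{1,\dots,k-1\}$ with $i\neq j$.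
   Context: For a finite field $E$ and its multiplicative subgroup $\Psi$ of order $k$, the pair $(E,\Psi)$ is circular if $|\Psi a\cap(\Psi b+c)|\leq 2$ for all $a,b,c\in E^{*}$. The pair $(p,k)$ is called circular if $(\mathrm{GF}(p^{r'}),\Psi)$ is circular for some $r'\in\mathbb{N}$ with $k\mid(p^{r'}-1)$; it is known (Modisett) that then $(\mathrm{GF}(p^{r}),\Phi)$ is circular for every $r$ with $k\mid(p^{r}-1)$. -}

module Defs where

open import Level using (0ℓ)
open import Data.Nat using (ℕ; zero; suc; _≤_; _∸_)
open import Data.Nat.Divisibility using (_∣_)
open import Data.Fin using (Fin)
open import Data.Product using (Σ; ∃; _×_; _,_)
open import Function.Bundles using (_↔_)
open import Function.Definitions using (Injective)
open import Relation.Binary.PropositionalEquality using (_≡_; _≢_)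
open import Algebra.Structures using (IsCommutativeRing)

-- A finite field with exactly q elements (equality is propositional).
-- Any such field is (isomorphic to) GF(q).
record FiniteField (q : ℕ) : Set₁ where
  infixl 7 _*_
  infixl 6 _+_
  field
    Carrier  : Set
    _+_ _*_  : Carrier → Carrier → Carrier
    -_       : Carrier → Carrier
    0# 1#    : Carrier
    _⁻¹      : Carrier → Carrier
    isCommutativeRing : IsCommutativeRing _≡_ _+_ _*_ -_ 0# 1#
    0≢1      : 0# ≢ 1#
    ⁻¹-inverse : ∀ x → x ≢ 0# → x * (x ⁻¹) ≡ 1#
    enumeration : Fin q ↔ Carrier

  _^_ : Carrier → ℕ → Carrier
  x ^ zero  = 1#
  x ^ suc n = x * (x ^ n)

  _-_ : Carrier → Carrier → Carrier
  x - y = x + (- y)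

  IsGenerator : Carrier → Set
  IsGenerator ζ = ζ ≢ 0# × (∀ x → x ≢ 0# → ∃ λ n → x ≡ ζ ^ n)

  HasCard : (Carrier → Set) → ℕ → Set
  HasCard P n = Σ (Fin n → Carrier) λ f →
    Injective _≡_ _≡_ f × (∀ i → P (f i)) × (∀ x → P x → ∃ λ i → f i ≡ x)

  CardAtMost : (Carrier → Set) → ℕ → Set
  CardAtMost P n = ∃ λ m → m ≤ n × HasCard P m

  coset : (Carrier → Set) → Carrier → Carrier → Set
  coset S a x = ∃ λ y → S y × x ≡ y * a

  translate : (Carrier → Set) → Carrier → Carrier → Carrier → Set
  translate S a c x = ∃ λ y → coset S a y × x ≡ y + c

  IsSubgroupOfOrder : (Carrier → Set) → ℕ → Set
  IsSubgroupOfOrder S k =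
    (∀ x → S x → x ≢ 0#) × S 1# ×
    (∀ x y → S x → S y → S (x * y)) ×
    (∀ x → S x → S (x ⁻¹)) × HasCard S k

  IsCircularPair : (Carrier → Set) → Set
  IsCircularPair Ψ = ∀ a b c → a ≢ 0# → b ≢ 0# → c ≢ 0# →
    CardAtMost (λ x → coset Ψ a x × translate Ψ b c x) 2

  generated : Carrier → Carrier → Set
  generated φ x = ∃ λ n → x ≡ φ ^ n

open FiniteField public

CircularPK : ℕ → ℕ → Set₁
CircularPK p k = ∃ λ r' → (k ∣ (p Data.Nat.^ r' ∸ 1)) ×
  Σ (FiniteField (p Data.Nat.^ r')) λ E →
    Σ (Carrier E → Set) λ Ψ → IsSubgroupOfOrder E Ψ k × IsCircularPair E Ψ

{-# OPTIONS --safe #-}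
module Submission where

-- If x = t a + c and u = v a + c are two points with x, t, u, v ∈ Φ, then i and j are read off
-- from φⁱ = x / u and φʲ = t / v, and solving for a and c gives the stated form; c ≠ 0 because
-- Φ ∩ Φ a is empty or has k ≥ 3 elements. Conversely the form exhibits two points. A third
-- one would be an equation P(φ) = 0 together with inequations R(φ) ≠ 0 over the prime field,
-- and such a system is also solved by some ψ in the circular group Ψ ⊆ E, where it yields
-- three points of a translated coset.

open import Level using (0ℓ)
open import Algebra.Bundles using (RawRing; CommutativeRing; CommutativeMonoid)
import Algebra.Properties.AbelianGroup
import Algebra.Properties.CommutativeMonoid.Sum
import Algebra.Properties.CommutativeSemigroup
import Algebra.Properties.Monoid.Mult
import Algebra.Properties.Ring
import Algebra.Properties.Semiring.Mult
import Algebra.Solver.Ring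
open import Algebra.Solver.Ring.AlmostCommutativeRing
  using (fromCommutativeRing; _-Raw-AlmostCommutative⟶_)
import Data.Nat
open import Data.Nat.Base as ℕ using (ℕ; zero; suc; pred; z≤n; s≤s; NonZero; _≤_; _<_; _≥_; _∸_)
open import Data.Nat.DivMod using (_%_; _/_; _mod_; m%n<n; m/n*n≡m; m≡m%n+[m/n]*n)
import Data.Nat.Properties as ℕ
open import Data.Nat.Divisibility using (_∣_; divides)
open import Data.Nat.GCD using (module Bézout; module GCD)
open import Data.Nat.Primality using (Prime; prime⇒irreducible; prime⇒nonZero)
open import Data.Fin.Base using (Fin; zero; suc; toℕ; punchIn; punchOut)
import Data.Fin.Properties as Fin
open import Data.Fin.Properties
  using (punchIn-injective; punchInᵢ≢i; punchIn-punchOut; injective⇒≤; toℕ-fromℕ<)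
open import Data.Fin.Permutation using (Permutation; permutation)
open import Data.List.Base using (List; []; _∷_; _++_; map; replicate)
open import Data.List.Relation.Unary.All using (All; []; _∷_)
open import Data.Maybe.Base using (Maybe; just; nothing)
open import Data.Product using (∃; _×_; _,_; proj₁; proj₂)
open import Data.Sum.Base using (inj₁; inj₂)
open import Data.Vec.Base as Vec using (Vec; []; _∷_; lookup)
open import Data.Vec.Relation.Unary.All as VecAll using ([]; _∷_) renaming (All to VecAll)
import Data.Vec.Relation.Unary.All.Properties as VecAll
open import Data.Vec.Relation.Unary.AllPairs using ([]; _∷_)
open import Data.Vec.Relation.Unary.Unique.Propositional.Properties using (lookup-injective)
open import Function.Base using (_∘_)
open import Function.Bundles using (_↔_; _⇔_; Inverse; mk⇔)
open import Function.Definitions using (Injective)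
open import Relation.Nullary using (¬_; Dec; yes; no; contradiction)
open import Relation.Binary.Definitions using (tri<; tri≈; tri>)
open import Relation.Nullary.Decidable using (map′; _×-dec_; ¬?)
open import Relation.Binary.PropositionalEquality
  using (_≡_; _≢_; refl; sym; trans; cong; cong₂; subst; module ≡-Reasoning)

open import Defs using (FiniteField; CircularPK)

-- The obstacle is that circularity is given in E, of order pˢ, and needed in F, of order pʳ, while
-- neither field need embed in the other. What they share is GF(p) and the equation xᵏ = 1. A third
-- point is therefore first freed of a and c: collinearity of the pairs (x, y) with x = y a + c is
-- one equation between powers of φ, hence a condition on φ alone. The element ψ is found separately
-- for each such system, without an isomorphism between the two groups of order k. It may have order
-- smaller than k, which is why every inequality needed in E is carried along as an inequation.
-- Coefficients are natural numbers, meaningful in both fields, and they link the fields because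
-- such a number vanishes in either one exactly when p divides it.

-- Algebra.Solver.Ring needs coefficients with computable equality: a pair (a , b)
-- stands for the image of a − b.
module IntegerSolver (R : CommutativeRing 0ℓ 0ℓ) where
  open CommutativeRing R hiding (refl) renaming (sym to ≈-sym; trans to ≈-trans)
  open Algebra.Properties.AbelianGroup +-abelianGroup using (⁻¹-∙-comm; ε⁻¹≈ε; ⁻¹-involutive)
  open Algebra.Properties.CommutativeSemigroup +-commutativeSemigroup using (interchange)
  open Algebra.Properties.Ring ring using (-‿distribˡ-*; -‿distribʳ-*)
  open Algebra.Properties.Semiring.Mult semiring
    using (×-homo-+; ×1-homo-*; ×-homo-1; ×-congˡ) renaming (_×_ to _·_)
  open import Relation.Binary.Reasoning.Setoid setoid

  coefficients : RawRing 0ℓ 0ℓ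
  coefficients = record
    { Carrier = ℕ × ℕ
    ; _≈_ = _≡_
    ; _+_ = λ (a , b) (c , d) → a ℕ.+ c , b ℕ.+ d
    ; _*_ = λ (a , b) (c , d) → a ℕ.* c ℕ.+ b ℕ.* d , a ℕ.* d ℕ.+ b ℕ.* c
    ; -_ = λ (a , b) → b , a
    ; 0# = 0 , 0
    ; 1# = 1 , 0
    }

  ⟦_⟧ : ℕ × ℕ → Carrier
  ⟦ a , b ⟧ = a · 1# - b · 1#

  -‿interchange : ∀ a b c d → (a + c) - (b + d) ≈ (a - b) + (c - d)
  -‿interchange a b c d = begin
    (a + c) - (b + d)       ≈⟨ +-congˡ (⁻¹-∙-comm b d) ⟨
    (a + c) + (- b + - d)   ≈⟨ interchange a c (- b) (- d) ⟩
    (a - b) + (c - d)       ∎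

  *-difference : ∀ a b c d → (a * c + b * d) - (a * d + b * c) ≈ (a - b) * (c - d)
  *-difference a b c d = begin
    (a * c + b * d) - (a * d + b * c)       ≈⟨ -‿interchange _ _ _ _ ⟩
    (a * c - a * d) + (b * d - b * c)       ≈⟨ +-cong (expand a c d) (≈-trans (expand b d c) flip) ⟩
    a * (c - d) + - b * (c - d)             ≈⟨ distribʳ (c - d) a (- b) ⟨
    (a - b) * (c - d)                       ∎
    where
    expand : ∀ x y z → x * y - x * z ≈ x * (y - z)
    expand x y z = ≈-trans (+-congˡ (-‿distribʳ-* x z)) (≈-sym (distribˡ x y (- z)))
    flip : b * (d - c) ≈ - b * (c - d)
    flip = begin
      b * (d - c)          ≈⟨ *-congˡ (+-comm d (- c)) ⟩
      b * (- c + d)        ≈⟨ *-congˡ (+-congˡ (⁻¹-involutive d)) ⟨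
      b * (- c + - - d)    ≈⟨ *-congˡ (⁻¹-∙-comm c (- d)) ⟩
      b * - (c - d)        ≈⟨ -‿distribʳ-* b (c - d) ⟨
      - (b * (c - d))      ≈⟨ -‿distribˡ-* b (c - d) ⟩
      - b * (c - d)        ∎

  homomorphism : coefficients -Raw-AlmostCommutative⟶ fromCommutativeRing R
  homomorphism = record
    { ⟦_⟧ = ⟦_⟧
    ; +-homo = λ (a , b) (c , d) → ≈-trans
        (+-cong (×-homo-+ 1# a c) (-‿cong (×-homo-+ 1# b d))) (-‿interchange _ _ _ _)
    ; *-homo = λ (a , b) (c , d) → ≈-trans
        (+-cong (·-bilinear a c b d) (-‿cong (·-bilinear a d b c))) (*-difference _ _ _ _)
    ; -‿homo = λ (a , b) → ≈-sym (begin
        - (a · 1# - b · 1#)      ≈⟨ ⁻¹-∙-comm _ _ ⟨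
        - (a · 1#) - - (b · 1#)  ≈⟨ +-congˡ (⁻¹-involutive _) ⟩
        - (a · 1#) + b · 1#      ≈⟨ +-comm _ _ ⟩
        b · 1# - a · 1#          ∎)
    ; 0-homo = -‿inverseʳ 0#
    ; 1-homo = ≈-trans (+-cong (×-homo-1 1#) ε⁻¹≈ε) (+-identityʳ 1#)
    }
    where
    ·-bilinear : ∀ a c b d →
      (a ℕ.* c ℕ.+ b ℕ.* d) · 1# ≈ (a · 1#) * (c · 1#) + (b · 1#) * (d · 1#)
    ·-bilinear a c b d = ≈-trans (×-homo-+ 1# (a ℕ.* c) (b ℕ.* d))
      (+-cong (×1-homo-* a c) (×1-homo-* b d))

  -- Cross sums decide whether two pairs denote the same integer. Answering `nothing` is sound even
  -- when the images agree, as can happen in positive characteristic.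
  _coeff≟_ : ∀ m n → Maybe (⟦ m ⟧ ≈ ⟦ n ⟧)
  (a , b) coeff≟ (c , d) with a ℕ.+ d ℕ.≟ c ℕ.+ b
  ... | no _ = nothing
  ... | yes a+d≡c+b = just (begin
    a · 1# - b · 1#                          ≈⟨ +-identityʳ _ ⟨
    (a · 1# - b · 1#) + 0#                   ≈⟨ +-congˡ (-‿inverseʳ (d · 1#)) ⟨
    (a · 1# - b · 1#) + (d · 1# - d · 1#)    ≈⟨ -‿interchange _ _ _ _ ⟨
    (a · 1# + d · 1#) - (b · 1# + d · 1#)    ≈⟨ +-cong a+d≈c+b (-‿cong (+-comm _ _)) ⟩
    (c · 1# + b · 1#) - (d · 1# + b · 1#)    ≈⟨ -‿interchange _ _ _ _ ⟩
    (c · 1# - d · 1#) + (b · 1# - b · 1#)    ≈⟨ +-congˡ (-‿inverseʳ (b · 1#)) ⟩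
    (c · 1# - d · 1#) + 0#                   ≈⟨ +-identityʳ _ ⟩
    c · 1# - d · 1#                          ∎)
    where
    a+d≈c+b : a · 1# + d · 1# ≈ c · 1# + b · 1#
    a+d≈c+b = ≈-trans (≈-sym (×-homo-+ 1# a d))
      (≈-trans (×-congˡ a+d≡c+b) (×-homo-+ 1# c b))

  open Algebra.Solver.Ring coefficients (fromCommutativeRing R) homomorphism _coeff≟_ public
    using (solve; _:+_; _:*_; _:-_; :-_; _:=_)

-- Translation invariance of finite sums

module _ (M : CommutativeMonoid 0ℓ 0ℓ) where
  open CommutativeMonoid M hiding (refl) renaming (sym to ≈-sym; trans to ≈-trans)
  open Algebra.Properties.CommutativeMonoid.Sum M
  open Algebra.Properties.Monoid.Mult monoid using () renaming (_×_ to _·_)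
  open import Relation.Binary.Reasoning.Setoid setoid

  -- Translation by g permutes the family f, which leaves its sum unchanged.
  ·-translation : ∀ {n} (f : Fin n → Carrier) → Injective _≡_ _≈_ f →
    ∀ g h → g ∙ h ≈ ε →
    (∀ i → ∃ λ j → f j ≈ g ∙ f i) → (∀ i → ∃ λ j → f j ≈ h ∙ f i) →
    sum f ≈ (n · g) ∙ sum f
  ·-translation {n} f f-injective g h gh≈ε g-closed h-closed = begin
    sum f                        ≈⟨ sum-permute f π ⟩
    sum (f ∘ to)                 ≈⟨ sum-cong-≋ (proj₂ ∘ g-closed) ⟩
    sum (λ i → g ∙ f i)          ≈⟨ ∑-distrib-+ (λ _ → g) f ⟩
    sum {n} (λ _ → g) ∙ sum f    ≈⟨ ∙-congʳ (sum-replicate n) ⟩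
    (n · g) ∙ sum f              ∎
    where
    to from : Fin n → Fin n
    to = proj₁ ∘ g-closed
    from = proj₁ ∘ h-closed
    cancel : ∀ g h → g ∙ h ≈ ε → ∀ x → g ∙ (h ∙ x) ≈ x
    cancel g h gh≈ε x = ≈-trans (≈-sym (assoc g h x)) (≈-trans (∙-congʳ gh≈ε) (identityˡ x))
    π : Permutation n n
    -- `from` inverts `to` because g and h cancel on the values of f; injectivity of f carries this
    -- back to the indices.
    π = permutation to from
      (λ i → f-injective (≈-trans (proj₂ (g-closed (from i)))
        (≈-trans (∙-congˡ (proj₂ (h-closed i))) (cancel g h gh≈ε (f i)))))
      (λ i → f-injective (≈-trans (proj₂ (h-closed (to i)))
        (≈-trans (∙-congˡ (proj₂ (g-closed i))) (cancel h g (≈-trans (comm h g) gh≈ε) (f i)))))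

-- Polynomials that can be evaluated in every field of characteristic p

-- A list of exponents stands for the polynomial Σ xᵉ. Over a field of characteristic p,
-- these polynomials are closed under subtraction because −1 = p − 1.
infixl 7 _⊠_
_⊠_ : List ℕ → List ℕ → List ℕ
[] ⊠ ts = []
(e ∷ ss) ⊠ ts = map (e ℕ.+_) ts ++ ss ⊠ ts

_⊠^_ : List ℕ → ℕ → List ℕ
ts ⊠^ zero = 0 ∷ []
ts ⊠^ suc n = ts ⊠ (ts ⊠^ n)

-- The factor `replicate (p ∸ 1) 0` consists of p - 1 copies of x⁰, which is the constant -1.
subtract : ℕ → List ℕ → List ℕ → List ℕ
subtract p ss ts = ss ++ replicate (p ∸ 1) 0 ⊠ ts

monomial-difference : ℕ → ℕ → ℕ → List ℕ
monomial-difference p e f = subtract p (e ∷ []) (f ∷ [])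

-- Folds several inequations into one: in a field the product is nonzero exactly when every factor
-- is.
∏-differences : ℕ → List (ℕ × ℕ) → List ℕ
∏-differences p [] = 0 ∷ []
∏-differences p ((e , f) ∷ es) = monomial-difference p e f ⊠ ∏-differences p es

-- Coefficients of the residue modulo xᵏ − 1.
residue : ∀ k .{{_ : NonZero k}} → List ℕ → Vec ℕ k
residue k [] = Vec.replicate k 0
residue k (e ∷ ts) = residue k ts Vec.[ e mod k ]%= suc

toℕ-mod : ∀ m n .{{_ : NonZero n}} → toℕ (m mod n) ≡ m % n
toℕ-mod m n = toℕ-fromℕ< (m%n<n m n)

-- Elementary arithmetic of a finite field

module Field {q} (F : FiniteField q) where
  open FiniteField F using
    ( Carrier; _^_; _⁻¹; 0≢1; ⁻¹-inverse; enumeration; isCommutativeRing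
    ; HasCard; IsGenerator; IsSubgroupOfOrder; IsCircularPair; generated; coset; translate)

  commutativeRing : CommutativeRing 0ℓ 0ℓ
  commutativeRing = record { isCommutativeRing = isCommutativeRing }

  open CommutativeRing commutativeRing hiding (Carrier; isCommutativeRing; zero; refl; sym; trans) public
  open Algebra.Properties.CommutativeSemigroup *-commutativeSemigroup
    using (x∙yz≈y∙xz)
  open Algebra.Properties.AbelianGroup +-abelianGroup
    using (x∙y⁻¹≈ε⇒x≈y; x≈y⇒x∙y⁻¹≈ε; identityˡ-unique; inverseʳ-unique) renaming (ε⁻¹≈ε to -0≡0) public
  open Algebra.Properties.Ring ring using (-1*x≈-x)
  open Algebra.Properties.Semiring.Mult semiring
    using (×-homo-+; ×1-homo-*; ×-homo-1) renaming (_×_ to _·_) public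
  open IntegerSolver commutativeRing
  open ≡-Reasoning

  infix 4 _≟_
  _≟_ : (x y : Carrier) → Dec (x ≡ y)
  x ≟ y = map′ (λ eq → trans (sym (strictlyInverseˡ x)) (trans (cong to eq) (strictlyInverseˡ y)))
    (cong from) (from x Fin.≟ from y)
    where open Inverse enumeration

  *-cancelˡ : ∀ {x y z} → x ≢ 0# → x * y ≡ x * z → y ≡ z
  *-cancelˡ {x} {y} {z} x≢0 xy≡xz = begin
    y                 ≡⟨ *-identityˡ y ⟨
    1# * y            ≡⟨ cong (_* y) (⁻¹-inverse x x≢0) ⟨
    x * x ⁻¹ * y      ≡⟨ swap y ⟩
    x ⁻¹ * (x * y)    ≡⟨ cong (x ⁻¹ *_) xy≡xz ⟩
    x ⁻¹ * (x * z)    ≡⟨ swap z ⟨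
    x * x ⁻¹ * z      ≡⟨ cong (_* z) (⁻¹-inverse x x≢0) ⟩
    1# * z            ≡⟨ *-identityˡ z ⟩
    z                 ∎
    where
    swap : ∀ w → x * x ⁻¹ * w ≡ x ⁻¹ * (x * w)
    swap w = trans (*-assoc x (x ⁻¹) w) (x∙yz≈y∙xz x (x ⁻¹) w)

  x*y≡0⇒y≡0 : ∀ {x y} → x ≢ 0# → x * y ≡ 0# → y ≡ 0#
  x*y≡0⇒y≡0 {x} x≢0 xy≡0 = *-cancelˡ x≢0 (trans xy≡0 (sym (zeroʳ x)))

  *-≢0 : ∀ {x y} → x ≢ 0# → y ≢ 0# → x * y ≢ 0#
  *-≢0 x≢0 y≢0 = y≢0 ∘ x*y≡0⇒y≡0 x≢0

  ⁻¹-≢0 : ∀ {x} → x ≢ 0# → x ⁻¹ ≢ 0#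
  ⁻¹-≢0 {x} x≢0 x⁻¹≡0 = 0≢1 (trans (sym (zeroʳ x))
    (trans (cong (x *_) (sym x⁻¹≡0)) (⁻¹-inverse x x≢0)))

  x≢y⇒x-y≢0 : ∀ {x y} → x ≢ y → x - y ≢ 0#
  x≢y⇒x-y≢0 {x} {y} x≢y = x≢y ∘ x∙y⁻¹≈ε⇒x≈y x y

  -- Powers, the characteristic and Lagrange's theorem

  ^-homo-* : ∀ x m n → x ^ (m ℕ.+ n) ≡ x ^ m * x ^ n
  ^-homo-* x zero n = sym (*-identityˡ _)
  ^-homo-* x (suc m) n = trans (cong (x *_) (^-homo-* x m n)) (sym (*-assoc _ _ _))

  1^n≡1 : ∀ n → 1# ^ n ≡ 1#
  1^n≡1 zero = refl
  1^n≡1 (suc n) = trans (*-identityˡ _) (1^n≡1 n)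

  ^-assocʳ : ∀ x m n → x ^ (m ℕ.* n) ≡ (x ^ n) ^ m
  ^-assocʳ x zero n = refl
  ^-assocʳ x (suc m) n = trans (^-homo-* x n (m ℕ.* n)) (cong (x ^ n *_) (^-assocʳ x m n))

  ^-≢0 : ∀ {x} n → x ≢ 0# → x ^ n ≢ 0#
  ^-≢0 zero x≢0 = 0≢1 ∘ sym
  ^-≢0 (suc n) x≢0 = *-≢0 x≢0 (^-≢0 n x≢0)

  -- Adding 1 permutes the field, so the sum S of all its elements satisfies S = q · 1 + S.
  q·1≡0 : q · 1# ≡ 0#
  q·1≡0 = identityˡ-unique _ _ (sym (·-translation +-commutativeMonoid to injective
    1# (- 1#) (-‿inverseʳ 1#) (λ i → from _ , strictlyInverseˡ _) (λ i → from _ , strictlyInverseˡ _)))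
    where
    open Inverse enumeration
    injective : Injective _≡_ _≡_ to
    injective {i} {j} eq = trans (sym (strictlyInverseʳ i)) (trans (cong from eq) (strictlyInverseʳ j))

  ·1-^ : ∀ m n → (m ℕ.^ n) · 1# ≡ (m · 1#) ^ n
  ·1-^ m zero = ×-homo-1 1#
  ·1-^ m (suc n) = trans (×1-homo-* m (m ℕ.^ n)) (cong (m · 1# *_) (·1-^ m n))

  -- q · 1 is the rth power of p · 1, and a power of a nonzero element is nonzero.
  p·1≡0 : ∀ {p r} → p ℕ.^ r ≡ q → p · 1# ≡ 0#
  p·1≡0 {p} {r} refl with p · 1# ≟ 0#
  ... | yes p·1≡0 = p·1≡0
  ... | no p·1≢0 = contradiction (trans (sym (·1-^ p r)) q·1≡0) (^-≢0 r p·1≢0)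

  -- Multiplication by x permutes Ψ, so the product of all elements of Ψ absorbs xⁿ; being nonzero,
  -- it cancels.
  subgroup-exponent : ∀ {Ψ n} → IsSubgroupOfOrder Ψ n → ∀ {x} → Ψ x → x ^ n ≡ 1#
  subgroup-exponent {Ψ} {n} (Ψ⇒≢0 , _ , Ψ-* , Ψ-⁻¹ , f , f-injective , f∈Ψ , f-covers) {x} x∈Ψ =
    *-cancelˡ (∏≢0 f (λ i → Ψ⇒≢0 _ (f∈Ψ i))) (begin
      sum f * x ^ n               ≡⟨ *-comm _ _ ⟩
      x ^ n * sum f               ≡⟨ cong (_* sum f) (·≡^ n) ⟨
      (n ·′ x) * sum f            ≡⟨ ·-translation *-commutativeMonoid f f-injective
                                       x (x ⁻¹) (⁻¹-inverse x (Ψ⇒≢0 x x∈Ψ))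
                                       (λ i → f-covers _ (Ψ-* _ _ x∈Ψ (f∈Ψ i)))
                                       (λ i → f-covers _ (Ψ-* _ _ (Ψ-⁻¹ x x∈Ψ) (f∈Ψ i))) ⟨
      sum f                       ≡⟨ *-identityʳ _ ⟨
      sum f * 1#                  ∎)
    where
    open Algebra.Properties.CommutativeMonoid.Sum *-commutativeMonoid using (sum)
    open Algebra.Properties.Monoid.Mult *-monoid using () renaming (_×_ to _·′_)
    ·≡^ : ∀ m → m ·′ x ≡ x ^ m
    ·≡^ zero = refl
    ·≡^ (suc m) = cong (x *_) (·≡^ m)
    ∏≢0 : ∀ {m} (g : Fin m → Carrier) → (∀ i → g i ≢ 0#) → sum g ≢ 0#
    ∏≢0 {zero} g g≢0 = 0≢1 ∘ sym
    ∏≢0 {suc m} g g≢0 = *-≢0 (g≢0 zero) (∏≢0 (g ∘ suc) (g≢0 ∘ suc))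

  units-subgroup : IsSubgroupOfOrder (_≢ 0#) (q ∸ 1)
  units-subgroup = (λ _ x≢0 → x≢0) , 0≢1 ∘ sym , (λ _ _ → *-≢0) , (λ _ → ⁻¹-≢0) , units-card enumeration
    where
    -- The size is generalised from q to n so that it can be split as `suc n`. The units are then
    -- enumerated by skipping the index z of 0.
    units-card : ∀ {n} → Fin n ↔ Carrier → HasCard (_≢ 0#) (n ∸ 1)
    units-card {zero} e with () ← Inverse.from e 0#
    units-card {suc n} e = (λ i → to (punchIn z i)) ,
      (λ {i} {j} eq → punchIn-injective z i j (to-injective eq)) ,
      (λ i eq → punchInᵢ≢i z i (to-injective (trans eq (sym (strictlyInverseˡ 0#))))) ,
      λ x x≢0 → let z≢x = λ eq → x≢0 (trans (sym (strictlyInverseˡ x)) (trans (cong to (sym eq)) (strictlyInverseˡ 0#)))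
        in punchOut z≢x , trans (cong to (punchIn-punchOut z≢x)) (strictlyInverseˡ x)
      where
      open Inverse e
      z : Fin (suc n)
      z = from 0#
      to-injective : Injective _≡_ _≡_ to
      to-injective {i} {j} eq = trans (sym (strictlyInverseʳ i)) (trans (cong from eq) (strictlyInverseʳ j))

  fermat : ∀ {x} → x ≢ 0# → x ^ (q ∸ 1) ≡ 1#
  fermat = subgroup-exponent units-subgroup

  -- Counting, and the order of a generator

  HasCard-≥ : ∀ {P : Carrier → Set} {m n} (f : Fin m → Carrier) → Injective _≡_ _≡_ f →
    (∀ i → P (f i)) → HasCard P n → m ≤ n
  HasCard-≥ f f-injective f∈P (g , _ , _ , g-covers) =
    injective⇒≤ {f = proj₁ ∘ index} λ {i} {j} eq → f-injective
      (trans (sym (proj₂ (index i))) (trans (cong g eq) (proj₂ (index j))))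
    where
    index : ∀ i → ∃ λ j → g j ≡ f i
    index i = g-covers _ (f∈P i)

  HasCard-≥3 : ∀ {P : Carrier → Set} {n x y z} → P x → P y → P z →
    x ≢ y → x ≢ z → y ≢ z → HasCard P n → 3 ≤ n
  HasCard-≥3 {P} {n} {x} {y} {z} x∈P y∈P z∈P x≢y x≢z y≢z =
    HasCard-≥ (lookup (x ∷ y ∷ z ∷ []))
      (lookup-injective ((x≢y ∷ x≢z ∷ []) ∷ (y≢z ∷ []) ∷ [] ∷ []) _ _)
      (VecAll.lookup⁺ {P = P} (x∈P ∷ y∈P ∷ z∈P ∷ []))

  -- Decidable equality turns the refutation of a third point into an enumeration of `P`.
  HasCard-2 : ∀ {P : Carrier → Set} {x y} → P x → P y → x ≢ y →
    (∀ {z} → P z → x ≢ z → ¬ y ≢ z) → HasCard P 2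
  HasCard-2 {P} {x} {y} x∈P y∈P x≢y no-third =
    lookup (x ∷ y ∷ []) , lookup-injective ((x≢y ∷ []) ∷ [] ∷ []) _ _ ,
    VecAll.lookup⁺ {P = P} (x∈P ∷ y∈P ∷ []) , covers
    where
    covers : ∀ z → P z → ∃ λ i → lookup (x ∷ y ∷ []) i ≡ z
    covers z z∈P with x ≟ z | y ≟ z
    ... | yes x≡z | _ = zero , x≡z
    ... | no _ | yes y≡z = suc zero , y≡z
    ... | no x≢z | no y≢z = contradiction y≢z (no-third z∈P x≢z)

  ^-% : ∀ {x} n .{{_ : NonZero n}} → x ^ n ≡ 1# → ∀ e → x ^ e ≡ x ^ (e % n)
  ^-% {x} n xⁿ≡1 e = begin
    x ^ e                            ≡⟨ cong (x ^_) (m≡m%n+[m/n]*n e n) ⟩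
    x ^ (e % n ℕ.+ e / n ℕ.* n)      ≡⟨ ^-homo-* x (e % n) _ ⟩
    x ^ (e % n) * x ^ (e / n ℕ.* n)  ≡⟨ cong (x ^ (e % n) *_) (trans (^-assocʳ x (e / n) n)
                                          (trans (cong (_^ (e / n)) xⁿ≡1) (1^n≡1 (e / n)))) ⟩
    x ^ (e % n) * 1#                 ≡⟨ *-identityʳ _ ⟩
    x ^ (e % n)                      ∎

  -- If ζᵈ = 1, every unit is a power of ζ with exponent below d, so the q - 1 units inject into
  -- `Fin d`.
  generator-order : ∀ {ζ} → IsGenerator ζ → ∀ {d} .{{_ : NonZero d}} → ζ ^ d ≡ 1# → q ∸ 1 ≤ d
  generator-order {ζ} (_ , ζ-generates) {d} ζᵈ≡1
    with f , f-injective , f≢0 , _ ← proj₂ (proj₂ (proj₂ (proj₂ units-subgroup))) =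
    injective⇒≤ {f = λ i → log i mod d} λ {i} {j} eq → f-injective (begin
      f i               ≡⟨ f≡ i ⟩
      ζ ^ (log i % d)   ≡⟨ cong (ζ ^_) (toℕ-mod (log i) d) ⟨
      ζ ^ toℕ (log i mod d)   ≡⟨ cong (λ k → ζ ^ toℕ k) eq ⟩
      ζ ^ toℕ (log j mod d)   ≡⟨ cong (ζ ^_) (toℕ-mod (log j) d) ⟩
      ζ ^ (log j % d)   ≡⟨ f≡ j ⟨
      f j               ∎)
    where
    log : Fin (q ∸ 1) → ℕ
    log i = proj₁ (ζ-generates (f i) (f≢0 i))
    f≡ : ∀ i → f i ≡ ζ ^ (log i % d)
    f≡ i = trans (proj₂ (ζ-generates (f i) (f≢0 i))) (^-% d ζᵈ≡1 (log i))

  -- Polynomials as coefficient vectors and their roots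

  horner : ∀ {n} → Vec Carrier n → Carrier → Carrier
  horner [] x = 0#
  horner (a ∷ as) x = a + x * horner as x

  -- Synthetic division by x - r: the coefficients of the quotient are the values at r of the
  -- successive tails.
  quotient : ∀ {n} → Carrier → Vec Carrier (suc n) → Vec Carrier n
  quotient r (a ∷ []) = []
  quotient r (a ∷ as@(_ ∷ _)) = horner as r ∷ quotient r as

  horner-quotient : ∀ {n} r (as : Vec Carrier (suc n)) x →
    horner as x ≡ horner as r + (x - r) * horner (quotient r as) x
  horner-quotient r (a ∷ []) x =
    -- The variable `o` is instantiated at `0#`; the identity holds for any value of it.
    solve 4 (λ a x r o → a :+ x :* o := a :+ r :* o :+ (x :- r) :* o) refl a x r 0#
  horner-quotient r (a ∷ as@(_ ∷ _)) x = trans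
    (cong (λ h → a + x * h) (horner-quotient r as x))
    (solve 5 (λ a x r s t → a :+ x :* (s :+ (x :- r) :* t) := a :+ r :* s :+ (x :- r) :* (s :+ x :* t))
      refl a x r (horner as r) (horner (quotient r as) x))

  a+r0≡a : ∀ {a r z} → z ≡ 0# → a + r * z ≡ a
  a+r0≡a {a} {r} refl = trans (cong (a +_) (zeroʳ r)) (+-identityʳ a)

  -- The head of the quotient is the value of the tail at r. Its vanishing leaves the constant term
  -- as the value of the whole at r, and supplies the root hypothesis for the tail.
  quotient≡0⇒≡0 : ∀ {n} r (as : Vec Carrier (suc n)) → horner as r ≡ 0# →
    VecAll (_≡ 0#) (quotient r as) → VecAll (_≡ 0#) as
  quotient≡0⇒≡0 r (a ∷ []) a≡0 [] =
    trans (sym (a+r0≡a refl)) a≡0 ∷ []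
  quotient≡0⇒≡0 r (a ∷ as@(_ ∷ _)) a+≡0 (as≡0 ∷ q≡0) =
    trans (sym (a+r0≡a as≡0)) a+≡0
    ∷ quotient≡0⇒≡0 r as as≡0 q≡0

  -- Divide by x minus the first root. At any other root this factor is nonzero, so the quotient
  -- inherits the remaining roots and has one coefficient less.
  roots⇒≡0 : ∀ {n} (as : Vec Carrier n) (f : Fin n → Carrier) → Injective _≡_ _≡_ f →
    (∀ i → horner as (f i) ≡ 0#) → VecAll (_≡ 0#) as
  roots⇒≡0 [] f f-injective f-root = []
  roots⇒≡0 as@(_ ∷ _) f f-injective f-root =
    quotient≡0⇒≡0 (f zero) as (f-root zero)
      (roots⇒≡0 (quotient (f zero) as) (f ∘ suc) (Fin.suc-injective ∘ f-injective) λ i →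
        x*y≡0⇒y≡0 (x≢y⇒x-y≢0 (Fin.0≢1+n ∘ sym ∘ f-injective)) (begin
          (f (suc i) - f zero) * horner (quotient (f zero) as) (f (suc i))
            ≡⟨ +-identityˡ _ ⟨
          0# + (f (suc i) - f zero) * horner (quotient (f zero) as) (f (suc i))
            ≡⟨ cong (_+ (f (suc i) - f zero) * horner (quotient (f zero) as) (f (suc i))) (f-root zero) ⟨
          horner as (f zero) + (f (suc i) - f zero) * horner (quotient (f zero) as) (f (suc i))
            ≡⟨ horner-quotient (f zero) as (f (suc i)) ⟨
          horner as (f (suc i))
            ≡⟨ f-root (suc i) ⟩
          0#                      ∎))

  -- Evaluation of exponent lists

  eval : List ℕ → Carrier → Carrier
  eval [] x = 0#
  eval (e ∷ ts) x = x ^ e + eval ts x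

  eval-++ : ∀ ss ts x → eval (ss ++ ts) x ≡ eval ss x + eval ts x
  eval-++ [] ts x = sym (+-identityˡ _)
  eval-++ (e ∷ ss) ts x = trans (cong (x ^ e +_) (eval-++ ss ts x)) (sym (+-assoc _ _ _))

  eval-shift : ∀ e ts x → eval (map (e ℕ.+_) ts) x ≡ x ^ e * eval ts x
  eval-shift e [] x = sym (zeroʳ _)
  eval-shift e (t ∷ ts) x = trans (cong₂ _+_ (^-homo-* x e t) (eval-shift e ts x))
    (sym (distribˡ _ _ _))

  eval-⊠ : ∀ ss ts x → eval (ss ⊠ ts) x ≡ eval ss x * eval ts x
  eval-⊠ [] ts x = sym (zeroˡ _)
  eval-⊠ (e ∷ ss) ts x = begin
    eval (map (e ℕ.+_) ts ++ ss ⊠ ts) x         ≡⟨ eval-++ (map (e ℕ.+_) ts) (ss ⊠ ts) x ⟩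
    eval (map (e ℕ.+_) ts) x + eval (ss ⊠ ts) x ≡⟨ cong₂ _+_ (eval-shift e ts x) (eval-⊠ ss ts x) ⟩
    x ^ e * eval ts x + eval ss x * eval ts x   ≡⟨ distribʳ _ _ _ ⟨
    (x ^ e + eval ss x) * eval ts x             ∎

  eval-[0] : ∀ x → eval (0 ∷ []) x ≡ 1#
  eval-[0] x = +-identityʳ 1#

  eval-⊠^ : ∀ ts n x → eval (ts ⊠^ n) x ≡ eval ts x ^ n
  eval-⊠^ ts zero x = eval-[0] x
  eval-⊠^ ts (suc n) x = trans (eval-⊠ ts (ts ⊠^ n) x) (cong (eval ts x *_) (eval-⊠^ ts n x))

  eval-replicate : ∀ n x → eval (replicate n 0) x ≡ n · 1#
  eval-replicate zero x = refl
  eval-replicate (suc n) x = cong (1# +_) (eval-replicate n x)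

  eval-subtract : ∀ p .{{_ : NonZero p}} → p · 1# ≡ 0# → ∀ ss ts x →
    eval (subtract p ss ts) x ≡ eval ss x - eval ts x
  eval-subtract (suc p-1) p·1≡0 ss ts x = begin
    eval (ss ++ replicate p-1 0 ⊠ ts) x        ≡⟨ eval-++ ss (replicate p-1 0 ⊠ ts) x ⟩
    eval ss x + eval (replicate p-1 0 ⊠ ts) x  ≡⟨ cong (eval ss x +_) (eval-⊠ (replicate p-1 0) ts x) ⟩
    eval ss x + eval (replicate p-1 0) x * eval ts x
      ≡⟨ cong (λ c → eval ss x + c * eval ts x) (trans (eval-replicate p-1 x) (inverseʳ-unique 1# _ p·1≡0)) ⟩
    eval ss x + - 1# * eval ts x               ≡⟨ cong (eval ss x +_) (-1*x≈-x (eval ts x)) ⟩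
    eval ss x - eval ts x                      ∎

  eval-monomial-difference : ∀ p .{{_ : NonZero p}} → p · 1# ≡ 0# → ∀ e f x →
    eval (monomial-difference p e f) x ≡ x ^ e - x ^ f
  eval-monomial-difference p p·1≡0 e f x = trans (eval-subtract p p·1≡0 (e ∷ []) (f ∷ []) x)
    (cong₂ _-_ (+-identityʳ _) (+-identityʳ _))

  -- This direction packs the inequations at φ in F; the converse below unpacks them at ψ in E.
  ∏-differences≢0⁺ : ∀ p .{{_ : NonZero p}} → p · 1# ≡ 0# → ∀ {x es} →
    All (λ (e , f) → x ^ e ≢ x ^ f) es → eval (∏-differences p es) x ≢ 0#
  ∏-differences≢0⁺ p p·1≡0 {x} [] eq = 0≢1 (trans (sym eq) (eval-[0] x))
  ∏-differences≢0⁺ p p·1≡0 {x} {(e , f) ∷ es} (xᵉ≢xᶠ ∷ rest) eq =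
    *-≢0 (x≢y⇒x-y≢0 xᵉ≢xᶠ) (∏-differences≢0⁺ p p·1≡0 rest) (trans
      (cong (_* eval (∏-differences p es) x) (sym (eval-monomial-difference p p·1≡0 e f x)))
      (trans (sym (eval-⊠ (monomial-difference p e f) (∏-differences p es) x)) eq))

  ∏-differences≢0⁻ : ∀ p .{{_ : NonZero p}} → p · 1# ≡ 0# → ∀ x es →
    eval (∏-differences p es) x ≢ 0# → All (λ (e , f) → x ^ e ≢ x ^ f) es
  ∏-differences≢0⁻ p p·1≡0 x [] ∏≢0 = []
  ∏-differences≢0⁻ p p·1≡0 x ((e , f) ∷ es) ∏≢0 =
    (λ xᵉ≡xᶠ → ∏≢0 (trans (eval-⊠ (monomial-difference p e f) (∏-differences p es) x) (trans
      (cong (_* eval (∏-differences p es) x)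
        (trans (eval-monomial-difference p p·1≡0 e f x) (x≈y⇒x∙y⁻¹≈ε xᵉ≡xᶠ)))
      (zeroˡ _))))
    ∷ ∏-differences≢0⁻ p p·1≡0 x es (λ ∏≡0 → ∏≢0 (trans
        (eval-⊠ (monomial-difference p e f) (∏-differences p es) x)
        (trans (cong (eval (monomial-difference p e f) x *_) ∏≡0) (zeroʳ _))))

  -- The right-hand side is the determinant that vanishes when the points (x^eᵢ, x^fᵢ) are
  -- collinear. It mentions neither slope nor intercept, so it makes sense in both fields.
  eval-collinearity : ∀ p .{{_ : NonZero p}} → p · 1# ≡ 0# → ∀ e₁ e₂ e₃ f₁ f₂ f₃ x →
    let δ = monomial-difference p in
    eval (subtract p (δ e₁ e₂ ⊠ δ f₁ f₃) (δ e₁ e₃ ⊠ δ f₁ f₂)) x ≡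
    (x ^ e₁ - x ^ e₂) * (x ^ f₁ - x ^ f₃) - (x ^ e₁ - x ^ e₃) * (x ^ f₁ - x ^ f₂)
  eval-collinearity p p·1≡0 e₁ e₂ e₃ f₁ f₂ f₃ x = trans
    (eval-subtract p p·1≡0 (δ e₁ e₂ ⊠ δ f₁ f₃) (δ e₁ e₃ ⊠ δ f₁ f₂) x)
    (cong₂ _-_ (eval-product e₁ e₂ f₁ f₃) (eval-product e₁ e₃ f₁ f₂))
    where
    δ : ℕ → ℕ → List ℕ
    δ = monomial-difference p
    eval-product : ∀ e e′ f f′ → eval (δ e e′ ⊠ δ f f′) x ≡ (x ^ e - x ^ e′) * (x ^ f - x ^ f′)
    eval-product e e′ f f′ = trans (eval-⊠ (δ e e′) (δ f f′) x)
      (cong₂ _*_ (eval-monomial-difference p p·1≡0 e e′ x) (eval-monomial-difference p p·1≡0 f f′ x))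

  -- For n = |E| - 1 the second factor is, on E, the indicator of the zeros of `ts`: it is 1 at a
  -- zero and 0 elsewhere.
  eval-⟨1-⟩ : ∀ p .{{_ : NonZero p}} → p · 1# ≡ 0# → ∀ ss ts n x →
    eval (ss ⊠ subtract p (0 ∷ []) (ts ⊠^ n)) x ≡ eval ss x * (1# - eval ts x ^ n)
  eval-⟨1-⟩ p p·1≡0 ss ts n x = trans (eval-⊠ ss (subtract p (0 ∷ []) (ts ⊠^ n)) x)
    (cong (eval ss x *_) (trans (eval-subtract p p·1≡0 (0 ∷ []) (ts ⊠^ n) x)
      (cong₂ _-_ (eval-[0] x) (eval-⊠^ ts n x))))

  -- Folding exponents modulo k leaves k coefficients, as many as Ψ has elements, which is the count
  -- that `roots⇒≡0` asks for.
  eval-residue : ∀ k .{{_ : NonZero k}} {x} → x ^ k ≡ 1# → ∀ ts →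
    eval ts x ≡ horner (Vec.map (_· 1#) (residue k ts)) x
  eval-residue k {x} xᵏ≡1 [] = sym (horner-0 k)
    where
    horner-0 : ∀ n → horner (Vec.map (_· 1#) (Vec.replicate n 0)) x ≡ 0#
    horner-0 zero = refl
    horner-0 (suc n) = trans (+-identityˡ _) (trans (cong (x *_) (horner-0 n)) (zeroʳ x))
  eval-residue k {x} xᵏ≡1 (e ∷ ts) = begin
    x ^ e + eval ts x
      ≡⟨ cong₂ _+_ (trans (^-% k xᵏ≡1 e) (cong (x ^_) (sym (toℕ-mod e k)))) (eval-residue k xᵏ≡1 ts) ⟩
    x ^ toℕ (e mod k) + horner (Vec.map (_· 1#) (residue k ts)) x
      ≡⟨ horner-suc (residue k ts) (e mod k) ⟨
    horner (Vec.map (_· 1#) (residue k (e ∷ ts))) x ∎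
    where
    horner-suc : ∀ {n} (cs : Vec ℕ n) i →
      horner (Vec.map (_· 1#) (cs Vec.[ i ]%= suc)) x ≡ x ^ toℕ i + horner (Vec.map (_· 1#) cs) x
    horner-suc (c ∷ cs) zero = +-assoc _ _ _
    horner-suc (c ∷ cs) (suc i) = trans (cong (λ h → c · 1# + x * h) (horner-suc cs i))
      (solve 4 (λ c x y h → c :+ x :* (y :+ h) := x :* y :+ (c :+ x :* h)) refl (c · 1#) x (x ^ toℕ i) _)

  horner≡0 : ∀ {n} (as : Vec Carrier n) x → VecAll (_≡ 0#) as → horner as x ≡ 0#
  horner≡0 [] x [] = refl
  horner≡0 (a ∷ as) x (refl ∷ as≡0) =
    trans (+-identityˡ _) (trans (cong (x *_) (horner≡0 as x as≡0)) (zeroʳ x))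

  -- Natural numbers that vanish in the field

  ∣⇒·1≡0 : ∀ {p n} → p · 1# ≡ 0# → p ∣ n → n · 1# ≡ 0#
  ∣⇒·1≡0 {p} p·1≡0 (divides c refl) = trans (×1-homo-* c p) (trans (cong (c · 1# *_) p·1≡0) (zeroʳ _))

  -- The gcd of n and p is 1 or p. If it were 1, a Bézout identity read in the field would give 1 =
  -- 0.
  ·1≡0⇒∣ : ∀ {p n} → Prime p → p · 1# ≡ 0# → n · 1# ≡ 0# → p ∣ n
  ·1≡0⇒∣ {p} {n} p-prime p·1≡0 n·1≡0
    with Bézout.lemma n p
  ... | Bézout.result d d-gcd bezout with prime⇒irreducible p-prime (GCD.gcd∣n d-gcd)
  ... | inj₂ refl = GCD.gcd∣m d-gcd
  ... | inj₁ refl = contradiction (1·1≡0 bezout) (0≢1 ∘ sym)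
    where
    unit : ∀ {m l u v} → m ∣ u → m · 1# ≡ 0# → l ∣ v → l · 1# ≡ 0# → 1 ℕ.+ u ≡ v → 1# ≡ 0#
    unit {m} {l} {u} {v} m∣u m·1≡0 l∣v l·1≡0 1+u≡v = begin
      1#               ≡⟨ +-identityʳ 1# ⟨
      1# + 0#          ≡⟨ cong (1# +_) (∣⇒·1≡0 m·1≡0 m∣u) ⟨
      1# + u · 1#      ≡⟨ cong (_· 1#) 1+u≡v ⟩
      v · 1#           ≡⟨ ∣⇒·1≡0 l·1≡0 l∣v ⟩
      0#               ∎
    1·1≡0 : Bézout.Identity 1 n p → 1# ≡ 0#
    1·1≡0 (Bézout.+- x y 1+yp≡xn) = unit (divides y refl) p·1≡0 (divides x refl) n·1≡0 1+yp≡xn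
    1·1≡0 (Bézout.-+ x y 1+xn≡yp) = unit (divides x refl) n·1≡0 (divides y refl) p·1≡0 1+xn≡yp

  0<q-1 : 0 < q ∸ 1
  0<q-1 = HasCard-≥ {m = 1} (λ _ → 1#) (λ { {zero} {zero} _ → refl }) (λ _ → 0≢1 ∘ sym)
    (proj₂ (proj₂ (proj₂ (proj₂ units-subgroup))))

  -- Circularity as a condition on collinear triples

  Ψ-^ : ∀ {Ψ n x} → IsSubgroupOfOrder Ψ n → Ψ x → ∀ e → Ψ (x ^ e)
  Ψ-^ (_ , 1∈Ψ , _) x∈Ψ zero = 1∈Ψ
  Ψ-^ Ψ-subgroup@(_ , _ , Ψ-* , _) x∈Ψ (suc e) = Ψ-* _ _ x∈Ψ (Ψ-^ Ψ-subgroup x∈Ψ e)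

  -- The three points lie on the graph of Y ↦ Y b + c for a unique pair b, c.
  circular⇒¬collinear : ∀ {Ψ X₁ X₂ X₃ Y₁ Y₂ Y₃} → IsCircularPair Ψ →
    Ψ X₁ → Ψ X₂ → Ψ X₃ → Ψ Y₁ → Ψ Y₂ → Ψ Y₃ →
    X₁ ≢ X₂ → X₁ ≢ X₃ → X₂ ≢ X₃ → Y₁ ≢ Y₂ → X₁ * Y₂ ≢ X₂ * Y₁ →
    (X₁ - X₂) * (Y₁ - Y₃) ≢ (X₁ - X₃) * (Y₁ - Y₂)
  circular⇒¬collinear {Ψ} {X₁} {X₂} {X₃} {Y₁} {Y₂} {Y₃} circular
    X₁∈Ψ X₂∈Ψ X₃∈Ψ Y₁∈Ψ Y₂∈Ψ Y₃∈Ψ X₁≢X₂ X₁≢X₃ X₂≢X₃ Y₁≢Y₂ X₁Y₂≢X₂Y₁ collinear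
    -- With representative `1#` the first coset is Ψ itself.
    = let m , m≤2 , card = circular 1# b c (0≢1 ∘ sym) b≢0 c≢0 in
      ℕ.<⇒≱ (s≤s m≤2) (HasCard-≥3
        (point X₁∈Ψ Y₁∈Ψ X₁≡) (point X₂∈Ψ Y₂∈Ψ X₂≡) (point X₃∈Ψ Y₃∈Ψ X₃≡) X₁≢X₂ X₁≢X₃ X₂≢X₃ card)
    where
    b c : Carrier
    b = (Y₁ - Y₂) ⁻¹ * (X₁ - X₂)
    c = X₁ - Y₁ * b
    Y₁-Y₂≢0 : Y₁ - Y₂ ≢ 0#
    Y₁-Y₂≢0 = x≢y⇒x-y≢0 Y₁≢Y₂
    b≢0 : b ≢ 0#
    b≢0 = *-≢0 (⁻¹-≢0 Y₁-Y₂≢0) (x≢y⇒x-y≢0 X₁≢X₂)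
    slope₂ : (Y₁ - Y₂) * b ≡ X₁ - X₂
    slope₂ = trans (sym (*-assoc _ _ _)) (trans (cong (_* (X₁ - X₂)) (⁻¹-inverse _ Y₁-Y₂≢0)) (*-identityˡ _))
    slope₃ : (Y₁ - Y₃) * b ≡ X₁ - X₃
    slope₃ = *-cancelˡ Y₁-Y₂≢0 (begin
      (Y₁ - Y₂) * ((Y₁ - Y₃) * b)    ≡⟨ x∙yz≈y∙xz _ _ _ ⟩
      (Y₁ - Y₃) * ((Y₁ - Y₂) * b)    ≡⟨ cong ((Y₁ - Y₃) *_) slope₂ ⟩
      (Y₁ - Y₃) * (X₁ - X₂)          ≡⟨ *-comm _ _ ⟩
      (X₁ - X₂) * (Y₁ - Y₃)          ≡⟨ collinear ⟩
      (X₁ - X₃) * (Y₁ - Y₂)          ≡⟨ *-comm _ _ ⟩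
      (Y₁ - Y₂) * (X₁ - X₃)          ∎)
    on-line : ∀ {X Y} → (Y₁ - Y) * b ≡ X₁ - X → X ≡ Y * b + c
    on-line {X} {Y} slope = begin
      X                       ≡⟨ solve 2 (λ x₁ x → x := x₁ :- (x₁ :- x)) refl X₁ X ⟩
      X₁ - (X₁ - X)           ≡⟨ cong (λ d → X₁ - d) slope ⟨
      X₁ - (Y₁ - Y) * b       ≡⟨ solve 4 (λ x₁ y₁ y b → x₁ :- (y₁ :- y) :* b := y :* b :+ (x₁ :- y₁ :* b))
                                   refl X₁ Y₁ Y b ⟩
      Y * b + (X₁ - Y₁ * b)   ∎
    X₁≡ : X₁ ≡ Y₁ * b + c
    X₁≡ = solve 2 (λ x y → x := y :+ (x :- y)) refl X₁ (Y₁ * b)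
    X₂≡ : X₂ ≡ Y₂ * b + c
    X₂≡ = on-line slope₂
    X₃≡ : X₃ ≡ Y₃ * b + c
    X₃≡ = on-line slope₃
    -- With c = 0 both X₁ = Y₁ b and X₂ = Y₂ b would hold, making the cross products equal.
    c≢0 : c ≢ 0#
    c≢0 c≡0 = X₁Y₂≢X₂Y₁ (begin
      X₁ * Y₂           ≡⟨ cong (_* Y₂) (through-0 X₁≡) ⟩
      Y₁ * b * Y₂       ≡⟨ solve 3 (λ x y z → x :* y :* z := z :* y :* x) refl Y₁ b Y₂ ⟩
      Y₂ * b * Y₁       ≡⟨ cong (_* Y₁) (through-0 X₂≡) ⟨
      X₂ * Y₁           ∎)
      where
      through-0 : ∀ {X Y} → X ≡ Y + c → X ≡ Y
      through-0 eq = trans eq (trans (cong (_ +_) c≡0) (+-identityʳ _))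
    point : ∀ {X Y} → Ψ X → Ψ Y → X ≡ Y * b + c → coset Ψ 1# X × translate Ψ b c X
    point {X} {Y} X∈Ψ Y∈Ψ X≡ = (X , X∈Ψ , sym (*-identityʳ X)) , (Y * b , (Y , Y∈Ψ , refl) , X≡)

  -- Cosets and primitive kth roots of unity

  x*[y-1]≡x*y-x : ∀ x y → x * (y - 1#) ≡ x * y - x
  x*[y-1]≡x*y-x x y = trans (solve 3 (λ x y o → x :* (y :- o) := x :* y :- x :* o) refl x y 1#)
    (cong (λ z → x * y - z) (*-identityʳ x))

  [y-1]*x≡y*x-x : ∀ x y → (y - 1#) * x ≡ y * x - x
  [y-1]*x≡y*x-x x y = trans (*-comm _ _) (trans (x*[y-1]≡x*y-x x y) (cong (_- x) (*-comm x y)))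

  -- Together with `coset⁻` this trades membership in S z⁻¹ w for the equation z x = y w, which
  -- keeps (φʲ - 1)⁻¹ out of the later calculations.
  coset⁺ : ∀ {S z x} w → z ≢ 0# → ∀ {y} → S y → z * x ≡ y * w → coset S (z ⁻¹ * w) x
  coset⁺ {S} {z} {x} w z≢0 {y} y∈S zx≡yw = y , y∈S , *-cancelˡ z≢0 (begin
    z * x                ≡⟨ zx≡yw ⟩
    y * w                ≡⟨ *-identityˡ _ ⟨
    1# * (y * w)         ≡⟨ cong (_* (y * w)) (⁻¹-inverse z z≢0) ⟨
    z * z ⁻¹ * (y * w)   ≡⟨ solve 4 (λ z z⁻¹ y w → z :* z⁻¹ :* (y :* w) := z :* (y :* (z⁻¹ :* w)))
                              refl z (z ⁻¹) y w ⟩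
    z * (y * (z ⁻¹ * w)) ∎)

  coset⁻ : ∀ {S z x w} → z ≢ 0# → coset S (z ⁻¹ * w) x → ∃ λ y → S y × z * x ≡ y * w
  coset⁻ {S} {z} {x} {w} z≢0 (y , y∈S , refl) = y , y∈S , (begin
    z * (y * (z ⁻¹ * w)) ≡⟨ solve 4 (λ z z⁻¹ y w → z :* z⁻¹ :* (y :* w) := z :* (y :* (z⁻¹ :* w)))
                              refl z (z ⁻¹) y w ⟨
    z * z ⁻¹ * (y * w)   ≡⟨ cong (_* (y * w)) (⁻¹-inverse z z≢0) ⟩
    1# * (y * w)         ≡⟨ *-identityˡ _ ⟩
    y * w                ∎)

  record IsPrimitiveRoot (k : ℕ) (φ : Carrier) : Set where
    field
      φᵏ≡1 : φ ^ k ≡ 1#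
      φᵈ≢1 : ∀ {d} → 0 < d → d < k → φ ^ d ≢ 1#

  -- If 0 < d < k and φᵈ = 1, then ζ to the positive power d m is 1, although d m < k m = q - 1.
  generator⇒primitive : ∀ {ζ} → IsGenerator ζ → ∀ m k → m ℕ.* k ≡ q ∸ 1 → IsPrimitiveRoot k (ζ ^ m)
  generator⇒primitive {ζ} ζ-generator@(ζ≢0 , _) m k mk≡q-1 = record
    { φᵏ≡1 = trans (sym (^-assocʳ ζ k m))
        (trans (cong (ζ ^_) (trans (ℕ.*-comm k m) mk≡q-1)) (fermat ζ≢0))
    ; φᵈ≢1 = λ {d} 0<d d<k φᵈ≡1 →
        let instance
              m≢0 : NonZero m
              m≢0 = ℕ.m*n≢0⇒m≢0 m {{ℕ.>-nonZero (subst (0 <_) (sym mk≡q-1) 0<q-1)}}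
              d≢0 : NonZero d
              d≢0 = ℕ.>-nonZero 0<d
        in ℕ.<⇒≱ (subst (d ℕ.* m <_) (trans (ℕ.*-comm k m) mk≡q-1) (ℕ.*-monoˡ-< m d<k))
             (generator-order ζ-generator {{ℕ.m*n≢0 d m}} (trans (^-assocʳ ζ d m) φᵈ≡1))
    }

  module PrimitiveRoot {k φ} .{{_ : NonZero k}} (φ-primitive : IsPrimitiveRoot k φ) where
    open IsPrimitiveRoot φ-primitive

    Φ : Carrier → Set
    Φ = generated φ

    Φ-* : ∀ {x y} → Φ x → Φ y → Φ (x * y)
    Φ-* (m , refl) (n , refl) = m ℕ.+ n , sym (^-homo-* φ m n)

    -- `generated` allows only natural exponents, so the inverse of φᵉ is written as the power with
    -- exponent (k - 1) e.
    Φ-inverse : ∀ {x} → Φ x → ∃ λ y → Φ y × x * y ≡ 1#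
    Φ-inverse (e , refl) = φ ^ (pred k ℕ.* e) , (pred k ℕ.* e , refl) , (begin
      φ ^ e * φ ^ (pred k ℕ.* e)     ≡⟨ ^-homo-* φ e (pred k ℕ.* e) ⟨
      φ ^ (suc (pred k) ℕ.* e)       ≡⟨ cong (λ n → φ ^ (n ℕ.* e)) (ℕ.suc-pred k) ⟩
      φ ^ (k ℕ.* e)                  ≡⟨ cong (φ ^_) (ℕ.*-comm k e) ⟩
      φ ^ (e ℕ.* k)                  ≡⟨ ^-assocʳ φ e k ⟩
      (φ ^ k) ^ e                    ≡⟨ cong (_^ e) φᵏ≡1 ⟩
      1# ^ e                         ≡⟨ 1^n≡1 e ⟩
      1#                             ∎)

    Φ⇒≢0 : ∀ {x} → Φ x → x ≢ 0#
    Φ⇒≢0 x∈Φ refl with y , _ , 0y≡1 ← Φ-inverse x∈Φ = 0≢1 (trans (sym (zeroˡ y)) 0y≡1)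

    Φ-quotient : ∀ {x y} → Φ x → Φ y → ∃ λ i → i < k × y * φ ^ i ≡ x
    Φ-quotient {x} {y} x∈Φ y∈Φ
      with z , z∈Φ , yz≡1 ← Φ-inverse y∈Φ
      with e , xz≡φᵉ ← Φ-* x∈Φ z∈Φ = e % k , m%n<n e k , (begin
      y * φ ^ (e % k)  ≡⟨ cong (y *_) (trans xz≡φᵉ (^-% k φᵏ≡1 e)) ⟨
      y * (x * z)      ≡⟨ x∙yz≈y∙xz y x z ⟩
      x * (y * z)      ≡⟨ cong (x *_) yz≡1 ⟩
      x * 1#           ≡⟨ *-identityʳ x ⟩
      x                ∎)

    x*φⁱ≡y≢x⇒i>0 : ∀ {x y i} → x * φ ^ i ≡ y → y ≢ x → 1 ≤ i
    x*φⁱ≡y≢x⇒i>0 {x} {i = zero} x*1≡y y≢x = contradiction (trans (sym x*1≡y) (*-identityʳ x)) y≢x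
    x*φⁱ≡y≢x⇒i>0 {i = suc i} _ _ = s≤s z≤n

    φ^-<-≢ : ∀ {i j} → i < j → j < k → φ ^ i ≢ φ ^ j
    φ^-<-≢ {i} {j} i<j j<k φⁱ≡φʲ = φᵈ≢1 (ℕ.m<n⇒0<n∸m i<j) (ℕ.≤-<-trans (ℕ.m∸n≤m j i) j<k)
      (*-cancelˡ (Φ⇒≢0 (i , refl)) (begin
        φ ^ i * φ ^ (j ∸ i)    ≡⟨ ^-homo-* φ i (j ∸ i) ⟨
        φ ^ (i ℕ.+ (j ∸ i))    ≡⟨ cong (φ ^_) (ℕ.m+[n∸m]≡n (ℕ.<⇒≤ i<j)) ⟩
        φ ^ j                  ≡⟨ φⁱ≡φʲ ⟨
        φ ^ i                  ≡⟨ *-identityʳ _ ⟨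
        φ ^ i * 1#             ∎))

    φ^-≢ : ∀ {i j} → i < k → j < k → i ≢ j → φ ^ i ≢ φ ^ j
    φ^-≢ {i} {j} i<k j<k i≢j with ℕ.<-cmp i j
    ... | tri< i<j _ _ = φ^-<-≢ i<j j<k
    ... | tri≈ _ i≡j _ = contradiction i≡j i≢j
    ... | tri> _ _ j<i = φ^-<-≢ j<i i<k ∘ sym

    -- The index j - i modulo k is coded by adding k first: since i < k, the truncated subtraction
    -- is then exact.
    φ^-difference : ∀ {i j} → i < k → φ ^ i * φ ^ ((j ℕ.+ k ∸ i) % k) ≡ φ ^ j
    φ^-difference {i} {j} i<k = begin
      φ ^ i * φ ^ ((j ℕ.+ k ∸ i) % k)  ≡⟨ cong (φ ^ i *_) (^-% k φᵏ≡1 (j ℕ.+ k ∸ i)) ⟨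
      φ ^ i * φ ^ (j ℕ.+ k ∸ i)        ≡⟨ ^-homo-* φ i _ ⟨
      φ ^ (i ℕ.+ (j ℕ.+ k ∸ i))        ≡⟨ cong (φ ^_) (ℕ.m+[n∸m]≡n (ℕ.≤-trans (ℕ.<⇒≤ i<k) (ℕ.m≤n+m k j))) ⟩
      φ ^ (j ℕ.+ k)                    ≡⟨ ^-homo-* φ j k ⟩
      φ ^ j * φ ^ k                    ≡⟨ cong (φ ^ j *_) φᵏ≡1 ⟩
      φ ^ j * 1#                       ≡⟨ *-identityʳ _ ⟩
      φ ^ j                            ∎

    -- The points of Φ ∩ (Φ a + c)

    Meets : Carrier → Carrier → Carrier → Set
    Meets a c x = Φ x × translate Φ a c x

    meets⁻ : ∀ {a c x} → Meets a c x → ∃ λ y → Φ x × Φ y × x ≡ y * a + c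
    meets⁻ (x∈Φ , _ , (y , y∈Φ , refl) , x≡) = y , x∈Φ , y∈Φ , x≡

    meets⁺ : ∀ {a c x y} → Φ x → Φ y → x ≡ y * a + c → Meets a c x
    meets⁺ {a} x∈Φ y∈Φ x≡ = x∈Φ , _ , (_ , y∈Φ , refl) , x≡

    -- Φ ∩ Φ a is stable under multiplication by φ, so one point x brings φ x and φ² x with it.
    meets-0 : ∀ {a x} → k ≥ 3 → ∀ {n} → Meets a 0# x → HasCard (Meets a 0#) n → 3 ≤ n
    meets-0 {a} {x} k≥3 x-meets = HasCard-≥3 (shift 0) (shift 1) (shift 2)
      (distinct (s≤s z≤n) (ℕ.≤-trans (ℕ.n≤1+n 2) k≥3)) (distinct (s≤s z≤n) k≥3) (distinct ℕ.≤-refl k≥3)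
      where
      shift : ∀ n → Meets a 0# (φ ^ n * x)
      shift n with y , x∈Φ , y∈Φ , x≡ ← meets⁻ x-meets =
        meets⁺ (Φ-* (n , refl) x∈Φ) (Φ-* (n , refl) y∈Φ) (begin
          φ ^ n * x                 ≡⟨ cong (φ ^ n *_) (trans x≡ (+-identityʳ _)) ⟩
          φ ^ n * (y * a)           ≡⟨ *-assoc _ _ _ ⟨
          φ ^ n * y * a             ≡⟨ +-identityʳ _ ⟨
          φ ^ n * y * a + 0#        ∎)
      distinct : ∀ {i j} → i < j → j < k → φ ^ i * x ≢ φ ^ j * x
      distinct i<j j<k eq = φ^-<-≢ i<j j<k
        (*-cancelˡ (Φ⇒≢0 (proj₁ x-meets)) (trans (*-comm _ _) (trans eq (*-comm _ _))))

    c[_,_] : ℕ → ℕ → Carrier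
    c[ j , i ] = (φ ^ j - 1#) ⁻¹ * (φ ^ i - 1#)

    Parametrised : Carrier → Carrier → Set
    Parametrised a c = ∃ λ i → ∃ λ j → (1 ≤ i × i < k) × (1 ≤ j × j < k) × i ≢ j ×
      coset Φ c[ j , i ] a × coset Φ c[ j , (j ℕ.+ k ∸ i) % k ] c

    -- With I = φⁱ and J = φʲ, the points satisfy x = u I and t = v J. The difference of the two
    -- equations eliminates c and gives v (J - 1) a = u (I - 1). J times the second minus the first
    -- eliminates a and gives (J - 1) c = J u - x, where J = I D.
    two-points⇒parametrised : ∀ {a c x u} → c ≢ 0# → Meets a c x → Meets a c u → x ≢ u →
      Parametrised a c
    two-points⇒parametrised {a} {c} {x} {u} c≢0 x-meets u-meets x≢u
      with t , x∈Φ , t∈Φ , x≡ ← meets⁻ x-meets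
      with v , u∈Φ , v∈Φ , u≡ ← meets⁻ u-meets
      with i , i<k , uI≡x ← Φ-quotient x∈Φ u∈Φ
      with j , j<k , vJ≡t ← Φ-quotient t∈Φ v∈Φ
      with v⁻¹ , v⁻¹∈Φ , vv⁻¹≡1 ← Φ-inverse v∈Φ =
      i , j , (x*φⁱ≡y≢x⇒i>0 uI≡x x≢u , i<k) , (x*φⁱ≡y≢x⇒i>0 vJ≡t t≢v , j<k) , i≢j ,
      coset⁺ (I - 1#) J-1≢0 (Φ-* v⁻¹∈Φ u∈Φ) a-equation ,
      coset⁺ (D - 1#) J-1≢0 (Φ-* u∈Φ (i , refl)) c-equation
      where
      I J D : Carrier
      I = φ ^ i
      J = φ ^ j
      D = φ ^ ((j ℕ.+ k ∸ i) % k)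
      t≢v : t ≢ v
      t≢v refl = x≢u (trans x≡ (sym u≡))
      J-1≢0 : J - 1# ≢ 0#
      J-1≢0 = x≢y⇒x-y≢0 λ J≡1 → t≢v (trans (sym vJ≡t) (trans (cong (v *_) J≡1) (*-identityʳ v)))
      a-equation : (J - 1#) * a ≡ v⁻¹ * u * (I - 1#)
      a-equation = *-cancelˡ (Φ⇒≢0 v∈Φ) (begin
        v * ((J - 1#) * a)            ≡⟨ cong (v *_) ([y-1]*x≡y*x-x a J) ⟩
        v * (J * a - a)               ≡⟨ solve 4 (λ v j a c → v :* (j :* a :- a) := (v :* j :* a :+ c) :- (v :* a :+ c))
                                           refl v J a c ⟩
        (v * J * a + c) - (v * a + c) ≡⟨ cong₂ _-_ (trans (cong (λ w → w * a + c) vJ≡t) (sym x≡)) (sym u≡) ⟩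
        x - u                         ≡⟨ cong (_- u) uI≡x ⟨
        u * I - u                     ≡⟨ x*[y-1]≡x*y-x u I ⟨
        u * (I - 1#)                  ≡⟨ *-identityˡ _ ⟨
        1# * (u * (I - 1#))           ≡⟨ cong (_* (u * (I - 1#))) vv⁻¹≡1 ⟨
        v * v⁻¹ * (u * (I - 1#))      ≡⟨ solve 4 (λ v v⁻¹ u w → v :* v⁻¹ :* (u :* w) := v :* (v⁻¹ :* u :* w))
                                           refl v v⁻¹ u (I - 1#) ⟩
        v * (v⁻¹ * u * (I - 1#))      ∎)
      c-equation : (J - 1#) * c ≡ u * I * (D - 1#)
      c-equation = begin
        (J - 1#) * c                  ≡⟨ [y-1]*x≡y*x-x c J ⟩
        J * c - c                     ≡⟨ solve 4 (λ j c v a → j :* c :- c := j :* (v :* a :+ c) :- (v :* j :* a :+ c))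
                                           refl J c v a ⟩
        J * (v * a + c) - (v * J * a + c)
                                      ≡⟨ cong₂ (λ y z → J * y - z) (sym u≡) (trans (cong (λ w → w * a + c) vJ≡t) (sym x≡)) ⟩
        J * u - x                     ≡⟨ cong₂ (λ y z → y * u - z) (φ^-difference i<k) uI≡x ⟨
        I * D * u - u * I             ≡⟨ cong (_- u * I) (solve 3 (λ i d u → i :* d :* u := u :* i :* d) refl I D u) ⟩
        u * I * D - u * I             ≡⟨ x*[y-1]≡x*y-x (u * I) D ⟨
        u * I * (D - 1#)              ∎
      -- For i = j the exponent difference is trivial, so D = 1 and the equation for c forces c = 0.
      i≢j : i ≢ j
      i≢j refl = c≢0 (x*y≡0⇒y≡0 J-1≢0 (begin
        (J - 1#) * c                  ≡⟨ c-equation ⟩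
        u * I * (D - 1#)              ≡⟨ cong (λ d → u * I * (d - 1#)) D≡1 ⟩
        u * I * (1# - 1#)             ≡⟨ cong (u * I *_) (-‿inverseʳ 1#) ⟩
        u * I * 0#                    ≡⟨ zeroʳ _ ⟩
        0#                            ∎))
        where
        D≡1 : D ≡ 1#
        D≡1 = *-cancelˡ (Φ⇒≢0 (i , refl)) (trans (φ^-difference i<k) (sym (*-identityʳ I)))

    parametrised⇒two-points : ∀ {a c} → Parametrised a c →
      c ≢ 0# × ∃ λ x → ∃ λ u → Meets a c x × Meets a c u × x ≢ u
    parametrised⇒two-points {a} {c} (i , j , (1≤i , i<k) , (1≤j , j<k) , i≢j , a∈ , c∈)
      with J-1≢0 ← x≢y⇒x-y≢0 (φᵈ≢1 1≤j j<k)
      with α , α∈Φ , a-equation ← coset⁻ J-1≢0 a∈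
      with γ , γ∈Φ , c-equation ← coset⁻ J-1≢0 c∈
      with α⁻¹ , α⁻¹∈Φ , αα⁻¹≡1 ← Φ-inverse α∈Φ
      with I⁻¹ , I⁻¹∈Φ , II⁻¹≡1 ← Φ-inverse (i , refl) =
      -- The witnesses invert the previous lemma: there γ = u I = x and α = u / v, so u = γ I⁻¹, v =
      -- γ α⁻¹ I⁻¹ and t = v J = γ α⁻¹ D.
      c≢0 , γ , γ * I⁻¹ ,
      meets⁺ γ∈Φ (Φ-* (Φ-* γ∈Φ α⁻¹∈Φ) ((j ℕ.+ k ∸ i) % k , refl)) (*-cancelˡ J-1≢0 first) ,
      meets⁺ (Φ-* γ∈Φ I⁻¹∈Φ) (Φ-* (Φ-* γ∈Φ α⁻¹∈Φ) I⁻¹∈Φ) (*-cancelˡ J-1≢0 second) ,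
      λ γ≡γI⁻¹ → φᵈ≢1 1≤i i<k (begin
        I           ≡⟨ *-identityʳ I ⟨
        I * 1#      ≡⟨ cong (I *_) (*-cancelˡ (Φ⇒≢0 γ∈Φ) (trans (*-identityʳ γ) γ≡γI⁻¹)) ⟩
        I * I⁻¹     ≡⟨ II⁻¹≡1 ⟩
        1#          ∎)
      where
      I J D : Carrier
      I = φ ^ i
      J = φ ^ j
      D = φ ^ ((j ℕ.+ k ∸ i) % k)
      c≢0 : c ≢ 0#
      c≢0 c≡0 = φ^-≢ i<k j<k i≢j (begin
        I           ≡⟨ *-identityʳ I ⟨
        I * 1#      ≡⟨ cong (I *_) D≡1 ⟨
        I * D       ≡⟨ φ^-difference i<k ⟩
        J           ∎)
        where
        D≡1 : D ≡ 1#
        D≡1 = x∙y⁻¹≈ε⇒x≈y D 1# (x*y≡0⇒y≡0 (Φ⇒≢0 γ∈Φ)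
          (trans (sym c-equation) (trans (cong ((J - 1#) *_) c≡0) (zeroʳ _))))
      -- Both points have a Φ-coordinate of the form γ α⁻¹ y, with y = D for the first and y = I⁻¹
      -- for the second; this removes a and c for both at once.
      on-line : ∀ y → (J - 1#) * (γ * α⁻¹ * y * a + c) ≡ γ * ((I * y - y) + (D - 1#))
      on-line y = begin
        (J - 1#) * (γ * α⁻¹ * y * a + c)
          ≡⟨ solve 6 (λ j γ α⁻¹ y a c → j :* (γ :* α⁻¹ :* y :* a :+ c) := γ :* α⁻¹ :* y :* (j :* a) :+ j :* c)
               refl (J - 1#) γ α⁻¹ y a c ⟩
        γ * α⁻¹ * y * ((J - 1#) * a) + (J - 1#) * c
          ≡⟨ cong₂ (λ s t → γ * α⁻¹ * y * s + t) a-equation c-equation ⟩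
        γ * α⁻¹ * y * (α * (I - 1#)) + γ * (D - 1#)
          ≡⟨ solve 6 (λ γ α⁻¹ y α i d → γ :* α⁻¹ :* y :* (α :* i) :+ γ :* d := γ :* ((α :* α⁻¹) :* (i :* y) :+ d))
               refl γ α⁻¹ y α (I - 1#) (D - 1#) ⟩
        γ * (α * α⁻¹ * ((I - 1#) * y) + (D - 1#))
          ≡⟨ cong₂ (λ s t → γ * (s * t + (D - 1#))) αα⁻¹≡1 ([y-1]*x≡y*x-x y I) ⟩
        γ * (1# * (I * y - y) + (D - 1#))
          ≡⟨ cong (λ s → γ * (s + (D - 1#))) (*-identityˡ _) ⟩
        γ * ((I * y - y) + (D - 1#)) ∎
      first : (J - 1#) * γ ≡ (J - 1#) * (γ * α⁻¹ * D * a + c)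
      first = begin
        (J - 1#) * γ                     ≡⟨ *-comm _ _ ⟩
        γ * (J - 1#)                     ≡⟨ cong (λ s → γ * (s - 1#)) (φ^-difference i<k) ⟨
        γ * (I * D - 1#)                 ≡⟨ cong (γ *_) (solve 3 (λ x d o → x :- o := x :- d :+ (d :- o)) refl (I * D) D 1#) ⟩
        γ * ((I * D - D) + (D - 1#))     ≡⟨ on-line D ⟨
        (J - 1#) * (γ * α⁻¹ * D * a + c) ∎
      second : (J - 1#) * (γ * I⁻¹) ≡ (J - 1#) * (γ * α⁻¹ * I⁻¹ * a + c)
      second = begin
        (J - 1#) * (γ * I⁻¹)             ≡⟨ [y-1]*x≡y*x-x (γ * I⁻¹) J ⟩
        J * (γ * I⁻¹) - γ * I⁻¹          ≡⟨ cong (λ s → s * (γ * I⁻¹) - γ * I⁻¹) (φ^-difference i<k) ⟨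
        I * D * (γ * I⁻¹) - γ * I⁻¹      ≡⟨ solve 4 (λ i d γ i⁻¹ → i :* d :* (γ :* i⁻¹) :- γ :* i⁻¹ := γ :* ((i :* i⁻¹) :* d :- i⁻¹))
                                              refl I D γ I⁻¹ ⟩
        γ * (I * I⁻¹ * D - I⁻¹)          ≡⟨ cong (λ s → γ * (s * D - I⁻¹)) II⁻¹≡1 ⟩
        γ * (1# * D - I⁻¹)               ≡⟨ cong (λ s → γ * (s - I⁻¹)) (*-identityˡ D) ⟩
        γ * (D - I⁻¹)                    ≡⟨ cong (γ *_) (solve 3 (λ d i⁻¹ o → d :- i⁻¹ := o :- i⁻¹ :+ (d :- o)) refl D I⁻¹ 1#) ⟩
        γ * ((1# - I⁻¹) + (D - 1#))      ≡⟨ cong (λ s → γ * ((s - I⁻¹) + (D - 1#))) II⁻¹≡1 ⟨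
        γ * ((I * I⁻¹ - I⁻¹) + (D - 1#)) ≡⟨ on-line I⁻¹ ⟨
        (J - 1#) * (γ * α⁻¹ * I⁻¹ * a + c) ∎

-- Passage between the two fields

-- If P(ψ) = 0 implied R(ψ) = 0 for all ψ ∈ Ψ, then by Fermat T = R (1 − P^(|E|−1)) would
-- vanish on Ψ, which consists of k distinct kth roots of unity. So its residue modulo xᵏ − 1
-- would be zero modulo p, and T(φ) = R(φ) would vanish.
module _ {p r s k} .{{_ : NonZero k}} (p-prime : Prime p)
  (E : FiniteField (p ℕ.^ s)) (F : FiniteField (p ℕ.^ r)) where
  private
    module E = Field E
    module F = Field F
    open module 𝔼 = FiniteField E using () renaming (0# to 0ᴱ)
    open module 𝔽 = FiniteField F using () renaming (0# to 0ᶠ; 1# to 1ᶠ)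

    instance
      p≢0 : NonZero p
      p≢0 = prime⇒nonZero p-prime

    p≡0ᴱ : p E.· 𝔼.1# ≡ 0ᴱ
    p≡0ᴱ = E.p·1≡0 {p} {s} refl
    p≡0ᶠ : p F.· 1ᶠ ≡ 0ᶠ
    p≡0ᶠ = F.p·1≡0 {p} {r} refl

  transfer : ∀ {Ψ} → 𝔼.IsSubgroupOfOrder Ψ k → ∀ {φ} → φ 𝔽.^ k ≡ 1ᶠ →
    ∀ P R → F.eval P φ ≡ 0ᶠ → F.eval R φ ≢ 0ᶠ →
    ∃ λ ψ → Ψ ψ × E.eval P ψ ≡ 0ᴱ × E.eval R ψ ≢ 0ᴱ
  transfer {Ψ} Ψ-subgroup {φ} φᵏ≡1 P R Pφ≡0 Rφ≢0
    with f , f-injective , f∈Ψ , _ ← proj₂ (proj₂ (proj₂ (proj₂ Ψ-subgroup)))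
    -- A finite search over Ψ yields ψ itself; the polynomial argument only has to refute a failed
    -- search.
    with Fin.any? (λ i → (E.eval P (f i) E.≟ 0ᴱ) ×-dec ¬? (E.eval R (f i) E.≟ 0ᴱ))
  ... | yes (i , Pψ≡0 , Rψ≢0) = f i , f∈Ψ i , Pψ≡0 , Rψ≢0
  ... | no none = contradiction Tφ≡0 Tφ≢0
    where
    N = p ℕ.^ s ∸ 1
    T = R ⊠ subtract p (0 ∷ []) (P ⊠^ N)
    T-root : ∀ i → E.eval T (f i) ≡ 0ᴱ
    T-root i with E.eval P (f i) E.≟ 0ᴱ | E.eval R (f i) E.≟ 0ᴱ
    ... | _ | yes Rψ≡0 = trans (E.eval-⟨1-⟩ p p≡0ᴱ R P N (f i)) (trans (cong (𝔼._* (𝔼.1# E.- (E.eval P (f i) 𝔼.^ N))) Rψ≡0) (E.zeroˡ _))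
    ... | yes Pψ≡0 | no Rψ≢0 = contradiction (i , Pψ≡0 , Rψ≢0) none
    ... | no Pψ≢0 | no _ = trans (E.eval-⟨1-⟩ p p≡0ᴱ R P N (f i)) (trans
      (cong (λ u → E.eval R (f i) 𝔼.* (𝔼.1# 𝔼.+ 𝔼.- u)) (E.fermat Pψ≢0))
      (trans (cong (E.eval R (f i) 𝔼.*_) (E.-‿inverseʳ 𝔼.1#)) (E.zeroʳ _)))
    coefficients≡0 : VecAll (λ n → n E.· 𝔼.1# ≡ 0ᴱ) (residue k T)
    coefficients≡0 = VecAll.map⁻ (E.roots⇒≡0 (Vec.map (E._· 𝔼.1#) (residue k T)) f f-injective λ i →
      trans (sym (E.eval-residue k (E.subgroup-exponent Ψ-subgroup (f∈Ψ i)) T)) (T-root i))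
    Tφ≡0 : F.eval T φ ≡ 0ᶠ
    -- Here the fields change: a coefficient that vanishes in E is divisible by p, hence vanishes in
    -- F.
    Tφ≡0 = trans (F.eval-residue k φᵏ≡1 T) (F.horner≡0 (Vec.map (F._· 1ᶠ) (residue k T)) φ (VecAll.map⁺
      (VecAll.map (λ {n} n≡0ᴱ → F.∣⇒·1≡0 {n = n} p≡0ᶠ (E.·1≡0⇒∣ p-prime p≡0ᴱ n≡0ᴱ))
        coefficients≡0)))
    Tφ≢0 : F.eval T φ ≢ 0ᶠ
    Tφ≢0 Tφ≡0 = Rφ≢0 (begin
      F.eval R φ                                       ≡⟨ F.*-identityʳ _ ⟨
      F.eval R φ 𝔽.* 1ᶠ                                ≡⟨ cong (F.eval R φ 𝔽.*_) 1-0≡1 ⟨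
      F.eval R φ 𝔽.* (1ᶠ 𝔽.+ 𝔽.- (0ᶠ 𝔽.^ N))           ≡⟨ cong (λ u → F.eval R φ 𝔽.* (1ᶠ 𝔽.+ 𝔽.- (u 𝔽.^ N))) Pφ≡0 ⟨
      F.eval R φ 𝔽.* (1ᶠ 𝔽.+ 𝔽.- (F.eval P φ 𝔽.^ N))   ≡⟨ F.eval-⟨1-⟩ p p≡0ᶠ R P N φ ⟨
      F.eval T φ                                       ≡⟨ Tφ≡0 ⟩
      0ᶠ                                               ∎)
      where
      open ≡-Reasoning
      -- The exponent N must be positive, since `0ᶠ 𝔽.^ 0` is 1.
      0^n≡0 : ∀ {n} → 0 < n → 0ᶠ 𝔽.^ n ≡ 0ᶠ
      0^n≡0 (s≤s _) = F.zeroˡ _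
      1-0≡1 : 1ᶠ 𝔽.+ 𝔽.- (0ᶠ 𝔽.^ N) ≡ 1ᶠ
      1-0≡1 = trans (cong (λ u → 1ᶠ 𝔽.+ 𝔽.- u) (0^n≡0 E.0<q-1))
        (trans (cong (1ᶠ 𝔽.+_) F.-0≡0) (F.+-identityʳ 1ᶠ))

  -- Both coordinates of each point are powers of φ. Keeping the six exponents and replacing φ by ψ
  -- gives a triple in E, whose own slope and intercept are then recomputed by
  -- `circular⇒¬collinear`.
  circular⇒¬three-points : ∀ {Ψ φ} → 𝔼.IsSubgroupOfOrder Ψ k → 𝔼.IsCircularPair Ψ →
    (φ-primitive : F.IsPrimitiveRoot k φ) → let open F.PrimitiveRoot φ-primitive in
    ∀ {a c x₁ x₂ x₃} → c ≢ 0ᶠ → Meets a c x₁ → Meets a c x₂ → Meets a c x₃ →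
    x₁ ≢ x₂ → x₁ ≢ x₃ → ¬ x₂ ≢ x₃
  circular⇒¬three-points {Ψ} {φ} Ψ-subgroup circular φ-primitive {a} {c} c≢0
    meets₁ meets₂ meets₃ x₁≢x₂ x₁≢x₃ x₂≢x₃
    with _ , (e₁ , refl) , (f₁ , refl) , x₁≡ ← F.PrimitiveRoot.meets⁻ φ-primitive meets₁
    with _ , (e₂ , refl) , (f₂ , refl) , x₂≡ ← F.PrimitiveRoot.meets⁻ φ-primitive meets₂
    with _ , (e₃ , refl) , (f₃ , refl) , x₃≡ ← F.PrimitiveRoot.meets⁻ φ-primitive meets₃ =
    conclude (transfer Ψ-subgroup φᵏ≡1 P (∏-differences p distinct) Pφ≡0
      (F.∏-differences≢0⁺ p p≡0ᶠ {φ} {distinct} (x₁≢x₂ ∷ x₁≢x₃ ∷ x₂≢x₃ ∷ y₁≢y₂ ∷ x₁y₂≢x₂y₁ ∷ [])))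
    where
    open F.IsPrimitiveRoot φ-primitive using (φᵏ≡1)
    open ≡-Reasoning
    δ : ℕ → ℕ → List ℕ
    δ = monomial-difference p
    P : List ℕ
    P = subtract p (δ e₁ e₂ ⊠ δ f₁ f₃) (δ e₁ e₃ ⊠ δ f₁ f₂)
    -- The first three pairs keep the points apart, the fourth makes the slope in E well defined,
    -- and the last keeps the intercept nonzero.
    distinct : List (ℕ × ℕ)
    distinct = (e₁ , e₂) ∷ (e₁ , e₃) ∷ (e₂ , e₃) ∷ (f₁ , f₂) ∷ (e₁ ℕ.+ f₂ , e₂ ℕ.+ f₁) ∷ []
    x₁ = φ 𝔽.^ e₁
    x₂ = φ 𝔽.^ e₂
    x₃ = φ 𝔽.^ e₃
    y₁ = φ 𝔽.^ f₁
    y₂ = φ 𝔽.^ f₂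
    y₃ = φ 𝔽.^ f₃
    y₁≢y₂ : y₁ ≢ y₂
    y₁≢y₂ y₁≡y₂ = x₁≢x₂ (trans x₁≡ (trans (cong (λ y → y F.* a F.+ c) y₁≡y₂) (sym x₂≡)))
    -- The difference x₂ y₁ - x₁ y₂ equals (y₁ - y₂) c, a product of nonzero factors.
    x₁y₂≢x₂y₁ : φ 𝔽.^ (e₁ ℕ.+ f₂) ≢ φ 𝔽.^ (e₂ ℕ.+ f₁)
    x₁y₂≢x₂y₁ eq = F.*-≢0 (F.x≢y⇒x-y≢0 y₁≢y₂) c≢0 (begin
      (y₁ F.- y₂) F.* c
        ≡⟨ solve 4 (λ y₁ y₂ a c → (y₁ :- y₂) :* c := (y₂ :* a :+ c) :* y₁ :- (y₁ :* a :+ c) :* y₂) refl y₁ y₂ a c ⟩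
      (y₂ F.* a F.+ c) F.* y₁ F.- (y₁ F.* a F.+ c) F.* y₂
        ≡⟨ cong₂ (λ u v → u F.* y₁ F.- v F.* y₂) x₂≡ x₁≡ ⟨
      x₂ F.* y₁ F.- x₁ F.* y₂
        ≡⟨ F.x≈y⇒x∙y⁻¹≈ε (trans (sym (F.^-homo-* φ e₂ f₁)) (trans (sym eq) (F.^-homo-* φ e₁ f₂))) ⟩
      0ᶠ ∎)
      where open IntegerSolver F.commutativeRing
    slope : ∀ {x y x′ y′} → x ≡ y F.* a F.+ c → x′ ≡ y′ F.* a F.+ c → x F.- x′ ≡ (y F.- y′) F.* a
    slope {y = y} {y′ = y′} refl refl =
      solve 4 (λ y y′ a c → (y :* a :+ c) :- (y′ :* a :+ c) := (y :- y′) :* a) refl y y′ a c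
      where open IntegerSolver F.commutativeRing
    collinear : (x₁ F.- x₂) F.* (y₁ F.- y₃) ≡ (x₁ F.- x₃) F.* (y₁ F.- y₂)
    collinear = begin
      (x₁ F.- x₂) F.* (y₁ F.- y₃)            ≡⟨ cong (F._* (y₁ F.- y₃)) (slope x₁≡ x₂≡) ⟩
      (y₁ F.- y₂) F.* a F.* (y₁ F.- y₃)      ≡⟨ solve 3 (λ u v a → u :* a :* v := v :* a :* u) refl _ _ a ⟩
      (y₁ F.- y₃) F.* a F.* (y₁ F.- y₂)      ≡⟨ cong (F._* (y₁ F.- y₂)) (slope x₁≡ x₃≡) ⟨
      (x₁ F.- x₃) F.* (y₁ F.- y₂)            ∎
      where open IntegerSolver F.commutativeRing
    Pφ≡0 : F.eval P φ ≡ 0ᶠ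
    Pφ≡0 = trans (F.eval-collinearity p p≡0ᶠ e₁ e₂ e₃ f₁ f₂ f₃ φ) (F.x≈y⇒x∙y⁻¹≈ε collinear)
    conclude : ¬ (∃ λ ψ → Ψ ψ × E.eval P ψ ≡ 0ᴱ × E.eval (∏-differences p distinct) ψ ≢ 0ᴱ)
    conclude (ψ , ψ∈Ψ , Pψ≡0 , ∏≢0)
      with x₁≢x₂ ∷ x₁≢x₃ ∷ x₂≢x₃ ∷ y₁≢y₂ ∷ x₁y₂≢x₂y₁ ∷ [] ← E.∏-differences≢0⁻ p p≡0ᴱ ψ distinct ∏≢0 =
      E.circular⇒¬collinear circular (ψ^ e₁) (ψ^ e₂) (ψ^ e₃) (ψ^ f₁) (ψ^ f₂) (ψ^ f₃)
        x₁≢x₂ x₁≢x₃ x₂≢x₃ y₁≢y₂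
        (λ eq → x₁y₂≢x₂y₁ (trans (E.^-homo-* ψ e₁ f₂) (trans eq (sym (E.^-homo-* ψ e₂ f₁)))))
        (E.x∙y⁻¹≈ε⇒x≈y _ _ (trans (sym (E.eval-collinearity p p≡0ᴱ e₁ e₂ e₃ f₁ f₂ f₃ ψ)) Pψ≡0))
      where
      ψ^ : ∀ e → Ψ (ψ 𝔼.^ e)
      ψ^ = E.Ψ-^ Ψ-subgroup ψ∈Ψ

  -- The equivalence

  two-points⇔parametrised : k ≥ 3 → ∀ {Ψ φ} → 𝔼.IsSubgroupOfOrder Ψ k → 𝔼.IsCircularPair Ψ →
    (φ-primitive : F.IsPrimitiveRoot k φ) → let open F.PrimitiveRoot φ-primitive in
    ∀ a c → 𝔽.HasCard (Meets a c) 2 ⇔ Parametrised a c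
  two-points⇔parametrised k≥3 Ψ-subgroup Ψ-circular φ-primitive a c = mk⇔ to from
    where
    open F.PrimitiveRoot φ-primitive
    to : 𝔽.HasCard (Meets a c) 2 → Parametrised a c
    to card@(f , f-injective , f-meets , _) =
      two-points⇒parametrised c≢0 (f-meets zero) (f-meets (suc zero)) (Fin.0≢1+n ∘ f-injective)
      where
      c≢0 : c ≢ 0ᶠ
      c≢0 refl = ℕ.<⇒≱ (ℕ.n<1+n 2) (meets-0 k≥3 (f-meets zero) card)
    from : Parametrised a c → 𝔽.HasCard (Meets a c) 2
    from parameters =
      let c≢0 , x , u , x-meets , u-meets , x≢u = parametrised⇒two-points parameters in
      F.HasCard-2 x-meets u-meets x≢u λ w-meets →
        circular⇒¬three-points Ψ-subgroup Ψ-circular φ-primitive c≢0 x-meets u-meets w-meets x≢u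

open import Defs

theorem14 : (p r k : ℕ) → Prime p → k ≥ 3 → .{{_ : NonZero k}} →
    k ∣ (p Data.Nat.^ r ∸ 1) →
    (F : FiniteField (p Data.Nat.^ r)) →
    (ζ : Carrier F) → IsGenerator F ζ →
    CircularPK p k →
    (a c : Carrier F) → a ≢ 0# F →
    let m = (p Data.Nat.^ r ∸ 1) / k
        φ = _^_ F ζ m
        Φ = generated F φ
        cji : ℕ → ℕ → Carrier F
        cji j i = _*_ F (_⁻¹ F (_-_ F (_^_ F φ j) (1# F))) (_-_ F (_^_ F φ i) (1# F))
    in HasCard F (λ x → Φ x × translate F Φ a c x) 2
       ⇔ (∃ λ i → ∃ λ j → (1 ≤ i × i < k) × (1 ≤ j × j < k) × i ≢ j ×
            coset F Φ (cji j i) a × coset F Φ (cji j ((j Data.Nat.+ k ∸ i) % k)) c)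
theorem14 p r k p-prime k≥3 k∣q-1 F ζ ζ-generator (s , _ , E , Ψ , Ψ-subgroup , Ψ-circular) a c _ =
  two-points⇔parametrised {p} {r} {s} p-prime E F k≥3 Ψ-subgroup Ψ-circular φ-primitive a c
  where
  φ-primitive : Field.IsPrimitiveRoot F k (_^_ F ζ ((p Data.Nat.^ r ∸ 1) / k))
  φ-primitive = Field.generator⇒primitive F ζ-generator ((p Data.Nat.^ r ∸ 1) / k) k (m/n*n≡m k∣q-1)
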